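{- Let $\lambda\in\mathbb{R}$, let $r\ge s\ge1$ and $n\ge1$ be integers, and let $k\ge0$ be an integer. Then \[ \frac{(-1)^k}{k!}\sum_{p=0}^{k}(-1)^p\binom{k}{p}\bigg(\prod_{j=1}^{n}\big[(p+(j-1)(r-s))_s-(n-j)\lambda\big]\bigg)= \begin{cases} S_\lambda^{(r,s)}(n,k), & \text{if } 0\le k\le ns,\\ 0, & \text{if } k>ns. \end{cases} \]
   Context: Notation: $(x)_0=1$, $(x)_m=x(x-1)\cdots(x-m+1)$ for $m\ge1$. Let $D=\frac{d}{dx}$ and let $x$ also denote the operator of multiplication by $x$. The generalized degenerate $(r,s)$-Stirling numbers of the second kind $S_\lambda^{(r,s)}(n,k)$, $0\le k\le ns$, are defined by the operator identity \[ \prod_{k=0}^{n-1}\Big(x^{r}D^{s}-k\lambda\, x^{r-s}\Big)=x^{n(r-s)}\sum_{k=0}^{ns}S_\lambda^{(r,s)}(n,k)\,x^{k}D^{k}, \] where the product of operators is written with the factors $k=0,1,\dots,n-1$ from left to right. -}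

module Defs where

open import Algebra.Apartness.Bundles using (HeytingField; HeytingCommutativeRing)
open import Algebra.Bundles using (CommutativeRing)
import Algebra.Definitions.RawMonoid as RawMonoidOps
import Algebra.Properties.Semiring.Exp as SemiringExp
import Algebra.Properties.Semiring.Mult as SemiringMult
open import Data.Fin.Base using (Fin; toℕ)
open import Data.List.Base using (List; []; _∷_; map)
open import Data.Nat.Base as ℕ using (ℕ; zero; suc; NonZero; _∸_; _!)
open import Data.Nat.Properties using (_!≢0)
open import Data.Product.Base using (proj₁)
import Data.Vec.Functional as Vector
open import Function.Base using (id; _∘_)
import Function.Endo.Propositional as Endo

-- The scalars are those of an arbitrary Heyting field, used below in
-- characteristic zero, in place of ℝ (which is one, with x # y meaning that
-- x and y are at positive distance).
module DegenerateStirling {c ℓ₁ ℓ₂} (K : HeytingField c ℓ₁ ℓ₂) where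

  open HeytingField K public
    using (Carrier; _≈_; _#_; _+_; _*_; -_; _-_; 0#; 1#; #⇒invertible)

  open HeytingCommutativeRing (HeytingField.heytingCommutativeRing K)
    using (commutativeRing)

  open CommutativeRing commutativeRing
    using (semiring; +-rawMonoid; *-rawMonoid)

  open SemiringExp semiring public using (_^_)
  open SemiringMult semiring using (_×_)

  fromℕ : ℕ → Carrier
  fromℕ n = n × 1#

  ∑[_]_ : ∀ n → (Fin n → Carrier) → Carrier
  ∑[ n ] f = RawMonoidOps.sum +-rawMonoid f

  ∏[_]_ : ∀ n → (Fin n → Carrier) → Carrier
  ∏[ n ] f = RawMonoidOps.sum *-rawMonoid f

  infix 5 ∑[_]_ ∏[_]_

  CharacteristicZero : Set ℓ₂
  CharacteristicZero = ∀ n → .{{NonZero n}} → fromℕ n # 0#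

  -- The library's #⇒invertible yields an inverse of x - 0#, which is ≈ x.
  recip : ∀ {x} → x # 0# → Carrier
  recip x#0 = proj₁ (#⇒invertible x#0)

  1/_! : ℕ → CharacteristicZero → Carrier
  (1/ k !) char0 = recip (char0 (k !) {{k !≢0}})

  infixl 8 _↓_

  _↓_ : Carrier → ℕ → Carrier
  x ↓ zero  = 1#
  x ↓ suc m = (x ↓ m) * (x - fromℕ m)

  -- Polynomials are coefficient lists, constant term first.  Trailing zeros
  -- are allowed, so polynomials are compared through their coefficients.
  Poly : Set c
  Poly = List Carrier

  coeff : Poly → ℕ → Carrier
  coeff []      _       = 0#
  coeff (a ∷ f) zero    = a
  coeff (a ∷ f) (suc i) = coeff f i

  infix  4 _≈ᵖ_
  infixl 6 _+ᵖ_ _-ᵖ_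
  infixl 7 _*ᵖ_

  _≈ᵖ_ : Poly → Poly → Set ℓ₁
  f ≈ᵖ g = ∀ i → coeff f i ≈ coeff g i

  _+ᵖ_ : Poly → Poly → Poly
  []      +ᵖ g       = g
  (a ∷ f) +ᵖ []      = a ∷ f
  (a ∷ f) +ᵖ (b ∷ g) = (a + b) ∷ (f +ᵖ g)

  _*ᵖ_ : Carrier → Poly → Poly
  a *ᵖ f = map (a *_) f

  _-ᵖ_ : Poly → Poly → Poly
  f -ᵖ g = f +ᵖ map -_ g

  Op : Set c
  Op = Poly → Poly

  open Endo Poly using () renaming (_^_ to _^ᵒ_) public

  infix  4 _≈ᵒ_
  infixl 6 _⊕_ _⊖_
  infixr 8 _•_

  _≈ᵒ_ : Op → Op → Set _
  T ≈ᵒ U = ∀ f → T f ≈ᵖ U f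

  _⊕_ _⊖_ : Op → Op → Op
  (T ⊕ U) f = T f +ᵖ U f
  (T ⊖ U) f = T f -ᵖ U f

  _•_ : Carrier → Op → Op
  (a • T) f = a *ᵖ T f

  𝟎 : Op
  𝟎 _ = []

  ⨁[_]_ : ∀ n → (Fin n → Op) → Op
  ⨁[ n ] T = Vector.foldr _⊕_ 𝟎 T

  -- T 0 ∘ T 1 ∘ ⋯ ∘ T (n - 1): the last factor acts first.
  ∘[_]_ : ∀ n → (Fin n → Op) → Op
  ∘[ n ] T = Vector.foldr (λ U V → U ∘ V) id T

  infix 5 ⨁[_]_ ∘[_]_

  X : Op
  X f = 0# ∷ f

  -- The Leibniz rule: d/dx (a + x f) = f + x (df/dx).
  D : Op
  D []      = []
  D (a ∷ f) = f +ᵖ X (D f)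

  -- S k plays the role of S_Λ^{(r,s)}(n,k); only its values at k ≤ n s are
  -- constrained.  Meant for s ≤ r, where r ∸ s is the true difference.
  IsDegenerateStirling₂ : (Λ : Carrier) (r s n : ℕ) (S : ℕ → Carrier) → Set _
  IsDegenerateStirling₂ Λ r s n S =
    (∘[ n ] λ k → ((X ^ᵒ r) ∘ (D ^ᵒ s)) ⊖ (fromℕ (toℕ k) * Λ) • (X ^ᵒ (r ∸ s)))
      ≈ᵒ
    ((X ^ᵒ (n ℕ.* (r ∸ s))) ∘
      (⨁[ suc (n ℕ.* s) ] λ k → S (toℕ k) • ((X ^ᵒ toℕ k) ∘ (D ^ᵒ toℕ k))))

{-# OPTIONS --safe #-}
-- An operator T that multiplies x^i by w i and raises its degree by d is a
-- weighted shift.  Both sides of the operator identity are weighted shifts by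
-- n (r - s); comparing their weights at i = p gives
--   ∏_j [(p + (j-1)(r-s))_s - (n-j) Λ] = ∑_k S k (p)_k.
-- The alternating binomial sum of order k is, up to sign, the k-th finite
-- difference at 0, which annihilates p ↦ (p)_j unless j = k.
module Submission where

open import Defs
open import Algebra.Apartness.Bundles using (HeytingField; HeytingCommutativeRing)
open import Algebra.Bundles using (CommutativeRing)
import Algebra.Properties.CommutativeMonoid.Sum as MonoidSum
import Algebra.Properties.CommutativeSemigroup as CommutativeSemigroupProperties
import Algebra.Properties.Ring as RingProperties
import Algebra.Properties.Semiring.Mult as SemiringMult
import Algebra.Properties.Semiring.Sum as SemiringSum
open import Data.Fin.Base as Fin using (Fin; toℕ)
import Data.Fin.Properties as Fin
open import Data.List.Base using ([]; _∷_; map)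
open import Data.Nat.Base as ℕ using (ℕ; zero; suc; _∸_; _≤_; _<_; s≤s; _!)
open import Data.Nat.Combinatorics using (_C_; k>n⇒nCk≡0; nCk+nC[k+1]≡[n+1]C[k+1])
import Data.Nat.Properties as ℕ
open import Data.Product.Base using (_×_; _,_; proj₁; proj₂)
open import Function.Base using (_∘_)
open import Relation.Binary.PropositionalEquality as ≡ using (_≡_; _≢_)
import Relation.Binary.Reasoning.Setoid as SetoidReasoning
open import Relation.Nullary.Decidable using (yes; no)
open import Relation.Nullary.Negation using (contradiction)

module _ {c ℓ₁ ℓ₂} (K : HeytingField c ℓ₁ ℓ₂) where

  open DegenerateStirling K

  private
    commutativeRing : CommutativeRing c ℓ₁
    commutativeRing =
      HeytingCommutativeRing.commutativeRing (HeytingField.heytingCommutativeRing K)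

  open CommutativeRing commutativeRing
    hiding (Carrier; _≈_; _+_; _*_; -_; _-_; 0#; 1#)
  open RingProperties ring
    using (-0#≈0#; -‿involutive; -‿+-comm; -1*x≈-x; [y-z]x≈yx-zx)
  open SemiringMult semiring using (×-homo-+; ×1-homo-*)
  open SemiringSum semiring
    using (sum-cong-≋; sum-init-last; sum-replicate-zero; ∑-comm; ∑-distrib-+; *-distribˡ-sum)
  -- Sums over the multiplicative monoid are products, so the sum lemmas become lemmas on `∏[_]_`.
  module ∏ = MonoidSum *-commutativeMonoid
  open CommutativeSemigroupProperties (CommutativeRing.*-commutativeSemigroup commutativeRing)
    using (x∙yz≈y∙xz; interchange)
  open CommutativeSemigroupProperties (CommutativeRing.+-commutativeSemigroup commutativeRing)
    using () renaming (interchange to +-interchange; xy∙z≈xz∙y to x+y+z≈x+z+y)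
  open SetoidReasoning setoid

  -- Ring identities and finite sums.

  x-0≈x : ∀ x → x - 0# ≈ x
  x-0≈x x = trans (+-congˡ -0#≈0#) (+-identityʳ x)

  x+y-x≈y : ∀ x y → x + y - x ≈ y
  x+y-x≈y x y = begin
    x + y - x    ≈⟨ x+y+z≈x+z+y x y (- x) ⟩
    x - x + y    ≈⟨ +-congʳ (-‿inverseʳ x) ⟩
    0# + y       ≈⟨ +-identityˡ y ⟩
    y            ∎

  [x+y]-[x+z]≈y-z : ∀ x y z → (x + y) - (x + z) ≈ y - z
  [x+y]-[x+z]≈y-z x y z = begin
    (x + y) - (x + z)      ≈⟨ +-congˡ (-‿+-comm x z) ⟨
    (x + y) + (- x - z)    ≈⟨ +-interchange x y (- x) (- z) ⟩
    (x - x) + (y - z)      ≈⟨ +-congʳ (-‿inverseʳ x) ⟩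
    0# + (y - z)           ≈⟨ +-identityˡ _ ⟩
    y - z                  ∎

  -1^k*-1^k≈1 : ∀ k → (- 1#) ^ k * (- 1#) ^ k ≈ 1#
  -1^k*-1^k≈1 zero    = *-identityˡ 1#
  -1^k*-1^k≈1 (suc k) = begin
    (- 1# * (- 1#) ^ k) * (- 1# * (- 1#) ^ k)  ≈⟨ interchange _ _ _ _ ⟩
    (- 1# * - 1#) * ((- 1#) ^ k * (- 1#) ^ k)  ≈⟨ *-cong (-1*x≈-x (- 1#)) (-1^k*-1^k≈1 k) ⟩
    - (- 1#) * 1#                              ≈⟨ *-identityʳ _ ⟩
    - (- 1#)                                   ≈⟨ -‿involutive 1# ⟩
    1#                                         ∎

  recip*x≈1 : ∀ {x} (x#0 : x # 0#) → recip x#0 * x ≈ 1#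
  recip*x≈1 {x} x#0 = begin
    recip x#0 * x         ≈⟨ *-congˡ (x-0≈x x) ⟨
    recip x#0 * (x - 0#)  ≈⟨ proj₁ (proj₂ (#⇒invertible x#0)) ⟩
    1#                    ∎

  ∑-zero : ∀ n (t : Fin n → Carrier) → (∀ i → t i ≈ 0#) → (∑[ n ] t) ≈ 0#
  ∑-zero n t t≈0 = trans (sum-cong-≋ t≈0) (sum-replicate-zero n)

  -- The summand lives on ℕ rather than `Fin n`, so that the induction can pass from `t` to
  -- `t ∘ suc` and lower `k` along with `n`.
  ∑-single : ∀ n k (t : ℕ → Carrier) → (∀ i → i ≢ k → t i ≈ 0#) → k < n →
             (∑[ n ] t ∘ toℕ) ≈ t k
  ∑-single (suc n) zero t t≈0 _ =
    trans (+-congˡ (∑-zero n _ λ i → t≈0 (suc (toℕ i)) λ ())) (+-identityʳ (t 0))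
  ∑-single (suc n) (suc k) t t≈0 (s≤s k<n) = trans
    (+-cong (t≈0 0 λ ())
            (∑-single n k (t ∘ suc) (λ i i≢k → t≈0 (suc i) (i≢k ∘ ℕ.suc-injective)) k<n))
    (+-identityˡ _)

  -- Falling factorials

  -- `_↓_` recurses on its last factor; this splits off the first one instead. The remaining factors
  -- match because (1 + x) - (1 + m) = x - m.
  [1+x]↓suc : ∀ x m → (1# + x) ↓ suc m ≈ (1# + x) * (x ↓ m)
  [1+x]↓suc x zero    = trans (*-identityˡ _) (trans (x-0≈x _) (sym (*-identityʳ _)))
  [1+x]↓suc x (suc m) = begin
    (1# + x) ↓ suc m * (1# + x - fromℕ (suc m))  ≈⟨ *-cong ([1+x]↓suc x m) ([x+y]-[x+z]≈y-z _ _ _) ⟩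
    (1# + x) * (x ↓ m) * (x - fromℕ m)           ≈⟨ *-assoc _ _ _ ⟩
    (1# + x) * (x ↓ suc m)                       ∎

  -- The power rule of the difference calculus: after splitting off the first factor, write 1 + x as
  -- (x - m) + (m + 1).
  ↓-difference : ∀ x m → (1# + x) ↓ suc m ≈ x ↓ suc m + fromℕ (suc m) * (x ↓ m)
  ↓-difference x m = begin
    (1# + x) ↓ suc m                                  ≈⟨ [1+x]↓suc x m ⟩
    (1# + x) * (x ↓ m)                                ≈⟨ *-congʳ 1+x≈ ⟨
    ((x - fromℕ m) + fromℕ (suc m)) * (x ↓ m)         ≈⟨ distribʳ _ _ _ ⟩
    (x - fromℕ m) * (x ↓ m) + fromℕ (suc m) * (x ↓ m) ≈⟨ +-congʳ (*-comm _ _) ⟩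
    x ↓ suc m + fromℕ (suc m) * (x ↓ m)               ∎
    where
    1+x≈ : (x - fromℕ m) + (1# + fromℕ m) ≈ 1# + x
    1+x≈ = begin
      (x - fromℕ m) + (1# + fromℕ m)   ≈⟨ +-congˡ (+-comm _ _) ⟩
      (x - fromℕ m) + (fromℕ m + 1#)   ≈⟨ +-interchange _ _ _ _ ⟩
      (x + fromℕ m) + (- fromℕ m + 1#) ≈⟨ +-assoc _ _ _ ⟩
      x + (fromℕ m + (- fromℕ m + 1#)) ≈⟨ +-congˡ (+-assoc _ _ _) ⟨
      x + (fromℕ m - fromℕ m + 1#)     ≈⟨ +-congˡ (+-congʳ (-‿inverseʳ _)) ⟩
      x + (0# + 1#)                    ≈⟨ +-congˡ (+-identityˡ 1#) ⟩
      x + 1#                           ≈⟨ +-comm x 1# ⟩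
      1# + x                           ∎

  0↓suc≈0 : ∀ m → 0# ↓ suc m ≈ 0#
  0↓suc≈0 zero    = trans (*-identityˡ _) (x-0≈x 0#)
  0↓suc≈0 (suc m) = trans (*-congʳ (0↓suc≈0 m)) (zeroˡ _)

  -- One of the factors is i - i. Splitting off first factors lowers `i` and `m` together until the
  -- base is 0.
  i<m⇒i↓m≈0 : ∀ {i m} → i < m → fromℕ i ↓ m ≈ 0#
  i<m⇒i↓m≈0 {zero}  {suc m} _         = 0↓suc≈0 m
  i<m⇒i↓m≈0 {suc i} {suc m} (s≤s i<m) = begin
    fromℕ (suc i) ↓ suc m          ≈⟨ [1+x]↓suc (fromℕ i) m ⟩
    fromℕ (suc i) * (fromℕ i ↓ m)  ≈⟨ *-congˡ (i<m⇒i↓m≈0 i<m) ⟩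
    fromℕ (suc i) * 0#             ≈⟨ zeroʳ _ ⟩
    0#                             ∎

  -- Alternating binomial sums

  signedC : ℕ → ℕ → Carrier
  signedC k i = (- 1#) ^ i * fromℕ (k C i)

  alternating : ℕ → (ℕ → Carrier) → ℕ → Carrier
  alternating k g i = signedC k i * g i

  -- This is (1 - E)^k g evaluated at 0, where E is the translation g ↦ `g ∘ suc`.
  Δ : ℕ → (ℕ → Carrier) → Carrier
  Δ k g = ∑[ suc k ] λ i → alternating k g (toℕ i)

  Δ-cong : ∀ k {g h} → (∀ i → g i ≈ h i) → Δ k g ≈ Δ k h
  Δ-cong k g≈h = sum-cong-≋ {suc k} λ i → *-congˡ {x = signedC k (toℕ i)} (g≈h (toℕ i))

  Δ-+ : ∀ k g h → Δ k (λ i → g i + h i) ≈ Δ k g + Δ k h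
  Δ-+ k g h = trans
    (sum-cong-≋ {suc k} λ i → distribˡ (signedC k (toℕ i)) (g (toℕ i)) (h (toℕ i)))
    (∑-distrib-+ {suc k} (alternating k g ∘ toℕ) (alternating k h ∘ toℕ))

  Δ-* : ∀ k a g → Δ k (λ i → a * g i) ≈ a * Δ k g
  Δ-* k a g = trans
    (sum-cong-≋ {suc k} λ i → x∙yz≈y∙xz (signedC k (toℕ i)) a (g (toℕ i)))
    (sym (*-distribˡ-sum {suc k} a (alternating k g ∘ toℕ)))

  Δ-∑ : ∀ k n (g : Fin n → ℕ → Carrier) →
        Δ k (λ i → ∑[ n ] λ j → g j i) ≈ (∑[ n ] λ j → Δ k (g j))
  Δ-∑ k n g = trans
    (sum-cong-≋ {suc k} λ i → *-distribˡ-sum {n} (signedC k (toℕ i)) λ j → g j (toℕ i))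
    (∑-comm {suc k} {n} λ i j → alternating k (g j) (toℕ i))

  -- Pascal's rule splits the binomial coefficient; the part with `k C i` keeps one surplus factor
  -- -1, hence the minus sign.
  alternating-pascal : ∀ k g i → alternating (suc k) g (suc i) ≈
                       alternating k g (suc i) - alternating k (g ∘ suc) i
  alternating-pascal k g i = begin
    - 1# * e * fromℕ (suc k C suc i) * y                ≡⟨ ≡.cong (λ m → - 1# * e * fromℕ m * y) pascal ⟨
    - 1# * e * fromℕ (k C suc i ℕ.+ k C i) * y          ≈⟨ *-congʳ (*-congˡ (×-homo-+ 1# (k C suc i) (k C i))) ⟩
    - 1# * e * (fromℕ (k C suc i) + fromℕ (k C i)) * y  ≈⟨ *-congʳ (distribˡ _ _ _) ⟩
    (- 1# * e * fromℕ (k C suc i) + - 1# * e * fromℕ (k C i)) * y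
                                                        ≈⟨ distribʳ _ _ _ ⟩
    alternating k g (suc i) + - 1# * e * fromℕ (k C i) * y
                                                        ≈⟨ +-congˡ (*-congʳ (*-assoc _ _ _)) ⟩
    alternating k g (suc i) + - 1# * (e * fromℕ (k C i)) * y
                                                        ≈⟨ +-congˡ (*-assoc _ _ _) ⟩
    alternating k g (suc i) + - 1# * (e * fromℕ (k C i) * y)
                                                        ≈⟨ +-congˡ (-1*x≈-x _) ⟩
    alternating k g (suc i) - alternating k (g ∘ suc) i ∎
    where
    e = (- 1#) ^ i
    y = g (suc i)
    pascal : k C suc i ℕ.+ k C i ≡ suc k C suc i
    pascal = ≡.trans (ℕ.+-comm (k C suc i) (k C i)) (nCk+nC[k+1]≡[n+1]C[k+1] k i)

  -- In terms of the translation E: (1 - E)^(k+1) = (1 - E)^k - (1 - E)^k E.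
  Δ-suc : ∀ k g → Δ (suc k) g ≈ Δ k g - Δ k (g ∘ suc)
  Δ-suc k g = begin
    alternating k g 0 + (∑[ suc k ] λ i → alternating (suc k) g (suc (toℕ i)))
      -- The term at 0 is left alone, being the same for `k` and `suc k`. Subtraction becomes
      -- multiplication by -1 so that the sign can later be pulled out of the sum.
      ≈⟨ +-congˡ (sum-cong-≋ {suc k} λ i → trans (alternating-pascal k g (toℕ i)) (+-congˡ (sym (-1*x≈-x _)))) ⟩
    alternating k g 0 + (∑[ suc k ] λ i → t (suc (toℕ i)) + - 1# * u (toℕ i))
      ≈⟨ +-congˡ (∑-distrib-+ {suc k} (t ∘ suc ∘ toℕ) λ i → - 1# * u (toℕ i)) ⟩
    t 0 + ((∑[ suc k ] t ∘ suc ∘ toℕ) + (∑[ suc k ] λ i → - 1# * u (toℕ i)))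
      ≈⟨ +-assoc _ _ _ ⟨
    (∑[ suc (suc k) ] t ∘ toℕ) + (∑[ suc k ] λ i → - 1# * u (toℕ i))
      ≈⟨ +-cong ∑t (trans (sym (*-distribˡ-sum {suc k} (- 1#) (u ∘ toℕ))) (-1*x≈-x _)) ⟩
    Δ k g - Δ k (g ∘ suc) ∎
    where
    t = alternating k g
    u = alternating k (g ∘ suc)

    -- The sum of `t` runs one index past the range of `Δ k`; the extra term dies with its binomial
    -- coefficient.
    t[1+k]≈0 : t (suc k) ≈ 0#
    t[1+k]≈0 = begin
      (- 1#) ^ suc k * fromℕ (k C suc k) * g (suc k)
        ≡⟨ ≡.cong (λ m → (- 1#) ^ suc k * fromℕ m * g (suc k)) (k>n⇒nCk≡0 (ℕ.n<1+n k)) ⟩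
      (- 1#) ^ suc k * 0# * g (suc k)  ≈⟨ *-congʳ (zeroʳ _) ⟩
      0# * g (suc k)                   ≈⟨ zeroˡ _ ⟩
      0#                               ∎

    ∑t : (∑[ suc (suc k) ] t ∘ toℕ) ≈ Δ k g
    ∑t = begin
      (∑[ suc (suc k) ] t ∘ toℕ)
        ≈⟨ sum-init-last {suc k} (t ∘ toℕ) ⟩
      (∑[ suc k ] λ i → t (toℕ (Fin.inject₁ i))) + t (toℕ (Fin.fromℕ (suc k)))
        ≈⟨ +-cong (sum-cong-≋ {suc k} λ i → reflexive (≡.cong t (Fin.toℕ-inject₁ i)))
                  (trans (reflexive (≡.cong t (Fin.toℕ-fromℕ (suc k)))) t[1+k]≈0) ⟩
      Δ k g + 0#
        ≈⟨ +-identityʳ _ ⟩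
      Δ k g ∎

  -- One difference is spent on the falling factorial, which lowers the order and the degree
  -- together. The sign appears because 1 - E is minus the forward difference.
  Δ-↓-suc : ∀ k j → Δ (suc k) (λ p → fromℕ p ↓ suc j) ≈
                    - (fromℕ (suc j) * Δ k (λ p → fromℕ p ↓ j))
  Δ-↓-suc k j = begin
    Δ (suc k) g                            ≈⟨ Δ-suc k g ⟩
    -- `fromℕ (suc p)` unfolds to `1# + fromℕ p`, the argument that `↓-difference` expects.
    Δ k g - Δ k (g ∘ suc)                  ≈⟨ +-congˡ (-‿cong (Δ-cong k λ p → ↓-difference (fromℕ p) j)) ⟩
    Δ k g - Δ k (λ p → g p + m * h p)      ≈⟨ +-congˡ (-‿cong (Δ-+ k g λ p → m * h p)) ⟩
    -- The added zero only brings the expression into the shape (x + y) - (x + z).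
    Δ k g - (Δ k g + Δ k (λ p → m * h p))  ≈⟨ +-congʳ (+-identityʳ _) ⟨
    (Δ k g + 0#) - (Δ k g + Δ k (λ p → m * h p)) ≈⟨ [x+y]-[x+z]≈y-z _ _ _ ⟩
    0# - Δ k (λ p → m * h p)               ≈⟨ +-identityˡ _ ⟩
    - Δ k (λ p → m * h p)                  ≈⟨ -‿cong (Δ-* k m h) ⟩
    - (m * Δ k h)                          ∎
    where
    m = fromℕ (suc j)
    g = λ p → fromℕ p ↓ suc j
    h = λ p → fromℕ p ↓ j

  -- Order and degree reach 0 together, and the descent from k collects the factors -k, ..., -1.
  Δ-↓-diagonal : ∀ k → Δ k (λ p → fromℕ p ↓ k) ≈ (- 1#) ^ k * fromℕ (k !)
  Δ-↓-diagonal zero    = trans (+-identityʳ _) (*-identityʳ _)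
  Δ-↓-diagonal (suc k) = begin
    Δ (suc k) (λ p → fromℕ p ↓ suc k)              ≈⟨ Δ-↓-suc k k ⟩
    - (fromℕ (suc k) * Δ k (λ p → fromℕ p ↓ k))    ≈⟨ -‿cong (*-congˡ (Δ-↓-diagonal k)) ⟩
    - (fromℕ (suc k) * ((- 1#) ^ k * fromℕ (k !))) ≈⟨ -‿cong (x∙yz≈y∙xz _ _ _) ⟩
    - ((- 1#) ^ k * (fromℕ (suc k) * fromℕ (k !))) ≈⟨ -‿cong (*-congˡ (×1-homo-* (suc k) (k !))) ⟨
    - ((- 1#) ^ k * fromℕ (suc k !))               ≈⟨ -1*x≈-x _ ⟨
    - 1# * ((- 1#) ^ k * fromℕ (suc k !))          ≈⟨ *-assoc _ _ _ ⟨
    (- 1#) ^ suc k * fromℕ (suc k !)               ∎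

  -- Order and degree descend together until exactly one is 0: either a falling factorial of
  -- positive degree is evaluated at 0, or a constant is differenced.
  Δ-↓-offDiagonal : ∀ k j → j ≢ k → Δ k (λ p → fromℕ p ↓ j) ≈ 0#
  Δ-↓-offDiagonal zero    zero    j≢k = contradiction ≡.refl j≢k
  Δ-↓-offDiagonal zero    (suc j) j≢k = begin
    Δ 0 (λ p → fromℕ p ↓ suc j)  ≈⟨ +-identityʳ _ ⟩
    1# * (1# + 0#) * (0# ↓ suc j) ≈⟨ *-congˡ (0↓suc≈0 j) ⟩
    1# * (1# + 0#) * 0#           ≈⟨ zeroʳ _ ⟩
    0#                            ∎
  Δ-↓-offDiagonal (suc k) zero    j≢k = trans (Δ-suc k λ _ → 1#) (-‿inverseʳ _)
  Δ-↓-offDiagonal (suc k) (suc j) j≢k = begin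
    Δ (suc k) (λ p → fromℕ p ↓ suc j)            ≈⟨ Δ-↓-suc k j ⟩
    - (fromℕ (suc j) * Δ k (λ p → fromℕ p ↓ j))  ≈⟨ -‿cong (*-congˡ (Δ-↓-offDiagonal k j (j≢k ∘ ≡.cong suc))) ⟩
    - (fromℕ (suc j) * 0#)                       ≈⟨ -‿cong (zeroʳ _) ⟩
    - 0#                                         ≈⟨ -0#≈0# ⟩
    0#                                           ∎

  -- Weighted shifts

  coeff-+ᵖ : ∀ f g i → coeff (f +ᵖ g) i ≈ coeff f i + coeff g i
  coeff-+ᵖ []      g       i       = sym (+-identityˡ _)
  coeff-+ᵖ (a ∷ f) []      i       = sym (+-identityʳ _)
  coeff-+ᵖ (a ∷ f) (b ∷ g) zero    = refl
  coeff-+ᵖ (a ∷ f) (b ∷ g) (suc i) = coeff-+ᵖ f g i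

  coeff-*ᵖ : ∀ a f i → coeff (a *ᵖ f) i ≈ a * coeff f i
  coeff-*ᵖ a []      i       = sym (zeroʳ a)
  coeff-*ᵖ a (b ∷ f) zero    = refl
  coeff-*ᵖ a (b ∷ f) (suc i) = coeff-*ᵖ a f i

  coeff-map- : ∀ f i → coeff (map -_ f) i ≈ - coeff f i
  coeff-map- []      i       = sym -0#≈0#
  coeff-map- (a ∷ f) zero    = refl
  coeff-map- (a ∷ f) (suc i) = coeff-map- f i

  coeff-⨁ : ∀ n (T : Fin n → Op) f i → coeff ((⨁[ n ] T) f) i ≈ (∑[ n ] λ k → coeff (T k f) i)
  coeff-⨁ zero    T f i = refl
  coeff-⨁ (suc n) T f i =
    trans (coeff-+ᵖ (T Fin.zero f) _ i) (+-congˡ (coeff-⨁ n (T ∘ Fin.suc) f i))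

  coeff-D : ∀ f i → coeff (D f) i ≈ fromℕ (suc i) * coeff f (suc i)
  coeff-D []      i       = sym (zeroʳ _)
  coeff-D (a ∷ f) zero    = begin
    coeff (f +ᵖ X (D f)) 0  ≈⟨ coeff-+ᵖ f (X (D f)) 0 ⟩
    coeff f 0 + 0#          ≈⟨ +-identityʳ _ ⟩
    coeff f 0               ≈⟨ *-identityˡ _ ⟨
    1# * coeff f 0          ≈⟨ *-congʳ (+-identityʳ 1#) ⟨
    (1# + 0#) * coeff f 0   ∎
  coeff-D (a ∷ f) (suc i) = begin
    coeff (f +ᵖ X (D f)) (suc i)                        ≈⟨ coeff-+ᵖ f (X (D f)) (suc i) ⟩
    -- The Leibniz rule adds one copy of the coefficient, from `f`, to the i + 1 copies from `D f`.
    coeff f (suc i) + coeff (D f) i                     ≈⟨ +-cong (sym (*-identityˡ _)) (coeff-D f i) ⟩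
    1# * coeff f (suc i) + fromℕ (suc i) * coeff f (suc i) ≈⟨ distribʳ _ _ _ ⟨
    fromℕ (suc (suc i)) * coeff f (suc i)               ∎

  -- The outermost `D` contributes i + 1 = (s + i + 1) - s, which is the last factor of the falling
  -- factorial of length s + 1.
  coeff-D^ : ∀ s f i → coeff ((D ^ᵒ s) f) i ≈ (fromℕ (s ℕ.+ i) ↓ s) * coeff f (s ℕ.+ i)
  coeff-D^ zero    f i = sym (*-identityˡ _)
  coeff-D^ (suc s) f i = begin
    coeff (D ((D ^ᵒ s) f)) i                   ≈⟨ coeff-D ((D ^ᵒ s) f) i ⟩
    fromℕ (suc i) * coeff ((D ^ᵒ s) f) (suc i) ≈⟨ *-congˡ (coeff-D^ s f (suc i)) ⟩
    fromℕ (suc i) * ((fromℕ (s ℕ.+ suc i) ↓ s) * coeff f (s ℕ.+ suc i))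
      ≈⟨ *-assoc _ _ _ ⟨
    fromℕ (suc i) * (fromℕ (s ℕ.+ suc i) ↓ s) * coeff f (s ℕ.+ suc i)
      ≈⟨ *-congʳ (trans (*-comm _ _) (*-congˡ (sym difference))) ⟩
    (fromℕ (s ℕ.+ suc i) ↓ suc s) * coeff f (s ℕ.+ suc i)
      ≡⟨ ≡.cong (λ m → (fromℕ m ↓ suc s) * coeff f m) (ℕ.+-suc s i) ⟩
    (fromℕ (suc s ℕ.+ i) ↓ suc s) * coeff f (suc s ℕ.+ i) ∎
    where
    difference : fromℕ (s ℕ.+ suc i) - fromℕ s ≈ fromℕ (suc i)
    difference = trans (+-congʳ (×-homo-+ 1# s (suc i))) (x+y-x≈y _ _)

  coeff-X^ : ∀ r f i → coeff ((X ^ᵒ r) f) (r ℕ.+ i) ≡ coeff f i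
  coeff-X^ zero    f i = ≡.refl
  coeff-X^ (suc r) f i = coeff-X^ r f i

  coeff-X^-low : ∀ {r i} f → i < r → coeff ((X ^ᵒ r) f) i ≡ 0#
  coeff-X^-low {suc r} {zero}  f _         = ≡.refl
  coeff-X^-low {suc r} {suc i} f (s≤s i<r) = coeff-X^-low f i<r

  -- The coefficients of T f below degree d are left unconstrained, since they
  -- do not influence the higher ones in a composition of shifts.
  IsShift : ℕ → (ℕ → Carrier) → Op → Set _
  IsShift d w T = ∀ f i → coeff (T f) (i ℕ.+ d) ≈ w i * coeff f i

  X^-isShift : ∀ d → IsShift d (λ _ → 1#) (X ^ᵒ d)
  X^-isShift d f i = begin
    coeff ((X ^ᵒ d) f) (i ℕ.+ d)  ≡⟨ ≡.cong (coeff ((X ^ᵒ d) f)) (ℕ.+-comm i d) ⟩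
    coeff ((X ^ᵒ d) f) (d ℕ.+ i)  ≡⟨ coeff-X^ d f i ⟩
    coeff f i                     ≈⟨ *-identityˡ _ ⟨
    1# * coeff f i                ∎

  X^D^-isShift : ∀ {r s} → s ≤ r → IsShift (r ∸ s) (λ i → fromℕ i ↓ s) ((X ^ᵒ r) ∘ (D ^ᵒ s))
  X^D^-isShift {r} {s} s≤r f i with s ℕ.≤? i
  ... | yes s≤i = begin
    coeff ((X ^ᵒ r) g) (i ℕ.+ (r ∸ s))         ≡⟨ ≡.cong (coeff ((X ^ᵒ r) g)) i+[r∸s]≡r+[i∸s] ⟩
    coeff ((X ^ᵒ r) g) (r ℕ.+ (i ∸ s))         ≡⟨ coeff-X^ r g (i ∸ s) ⟩
    coeff g (i ∸ s)                            ≈⟨ coeff-D^ s f (i ∸ s) ⟩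
    (fromℕ (s ℕ.+ (i ∸ s)) ↓ s) * coeff f (s ℕ.+ (i ∸ s))
      ≡⟨ ≡.cong (λ m → (fromℕ m ↓ s) * coeff f m) (ℕ.m+[n∸m]≡n s≤i) ⟩
    (fromℕ i ↓ s) * coeff f i                  ∎
    where
    g = (D ^ᵒ s) f
    i+[r∸s]≡r+[i∸s] : i ℕ.+ (r ∸ s) ≡ r ℕ.+ (i ∸ s)
    i+[r∸s]≡r+[i∸s] = ≡.trans (≡.sym (ℕ.+-∸-assoc i s≤r))
      (≡.trans (≡.cong (_∸ s) (ℕ.+-comm i r)) (ℕ.+-∸-assoc r s≤i))
  -- When i < s the target position lies below r, where multiplication by x^r leaves zeros; the
  -- weight vanishes as well, so it needs no case distinction.
  ... | no s≰i = begin
    coeff ((X ^ᵒ r) g) (i ℕ.+ (r ∸ s))  ≡⟨ coeff-X^-low g i+[r∸s]<r ⟩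
    0#                                  ≈⟨ zeroˡ _ ⟨
    0# * coeff f i                      ≈⟨ *-congʳ (i<m⇒i↓m≈0 i<s) ⟨
    (fromℕ i ↓ s) * coeff f i           ∎
    where
    g = (D ^ᵒ s) f
    i<s = ℕ.≰⇒> s≰i
    i+[r∸s]<r : i ℕ.+ (r ∸ s) < r
    i+[r∸s]<r = ≡.subst (i ℕ.+ (r ∸ s) <_) (ℕ.m+[n∸m]≡n s≤r) (ℕ.+-monoˡ-< (r ∸ s) i<s)

  ⊖-•-isShift : ∀ {d v w} T U a → IsShift d v T → IsShift d w U →
                IsShift d (λ i → v i - a * w i) (T ⊖ a • U)
  ⊖-•-isShift {d} {v} {w} T U a T-shift U-shift f i = begin
    coeff (T f +ᵖ map -_ (a *ᵖ U f)) j          ≈⟨ coeff-+ᵖ (T f) _ j ⟩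
    coeff (T f) j + coeff (map -_ (a *ᵖ U f)) j ≈⟨ +-congˡ (coeff-map- (a *ᵖ U f) j) ⟩
    coeff (T f) j - coeff (a *ᵖ U f) j          ≈⟨ +-congˡ (-‿cong (coeff-*ᵖ a (U f) j)) ⟩
    coeff (T f) j - a * coeff (U f) j           ≈⟨ +-cong (T-shift f i) (-‿cong (*-congˡ (U-shift f i))) ⟩
    v i * y - a * (w i * y)                     ≈⟨ +-congˡ (-‿cong (*-assoc a (w i) y)) ⟨
    v i * y - a * w i * y                       ≈⟨ [y-z]x≈yx-zx y (v i) (a * w i) ⟨
    (v i - a * w i) * y                         ∎
    where
    j = i ℕ.+ d
    y = coeff f i

  -- Position h, counted from the factor acting first, is occupied by the
  -- operator of index n - 1 - h.
  ∘-isShift : ∀ {d} n (T : Fin n → Op) (w : ℕ → ℕ → Carrier) →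
              (∀ k → IsShift d (w (toℕ k)) (T k)) →
              IsShift (n ℕ.* d)
                      (λ i → ∏[ n ] λ h → w (n ∸ suc (toℕ h)) (i ℕ.+ toℕ h ℕ.* d))
                      (∘[ n ] T)
  ∘-isShift {d} zero T w T-shift f i = begin
    coeff f (i ℕ.+ 0)  ≡⟨ ≡.cong (coeff f) (ℕ.+-identityʳ i) ⟩
    coeff f i          ≈⟨ *-identityˡ _ ⟨
    1# * coeff f i     ∎
  ∘-isShift {d} (suc n) T w T-shift f i = begin
    coeff (T Fin.zero g) (i ℕ.+ (d ℕ.+ n ℕ.* d))
      ≡⟨ ≡.cong (coeff (T Fin.zero g)) i+[d+nd]≡[i+nd]+d ⟩
    coeff (T Fin.zero g) ((i ℕ.+ n ℕ.* d) ℕ.+ d)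
      ≈⟨ T-shift Fin.zero g (i ℕ.+ n ℕ.* d) ⟩
    w 0 (i ℕ.+ n ℕ.* d) * coeff g (i ℕ.+ n ℕ.* d)
      ≈⟨ *-congˡ (∘-isShift n (T ∘ Fin.suc) (w ∘ suc) (T-shift ∘ Fin.suc) f i) ⟩
    w 0 (i ℕ.+ n ℕ.* d) * ((∏[ n ] λ h → w (suc (n ∸ suc (toℕ h))) (i ℕ.+ toℕ h ℕ.* d)) * coeff f i)
      ≈⟨ *-assoc _ _ _ ⟨
    w 0 (i ℕ.+ n ℕ.* d) * (∏[ n ] λ h → w (suc (n ∸ suc (toℕ h))) (i ℕ.+ toℕ h ℕ.* d)) * coeff f i
      -- `T Fin.zero` acts last, so its weight belongs at the far end of the product, whose last
      -- position is therefore the one split off.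
      ≈⟨ *-congʳ (trans (*-comm _ _) (*-cong (∏.sum-cong-≋ {n} initial) final)) ⟩
    (∏[ n ] λ h → v (toℕ (Fin.inject₁ h))) * v (toℕ (Fin.fromℕ n)) * coeff f i
      ≈⟨ *-congʳ (∏.sum-init-last {n} (v ∘ toℕ)) ⟨
    (∏[ suc n ] v ∘ toℕ) * coeff f i ∎
    where
    g = (∘[ n ] T ∘ Fin.suc) f

    v : ℕ → Carrier
    v h = w (n ∸ h) (i ℕ.+ h ℕ.* d)

    i+[d+nd]≡[i+nd]+d : i ℕ.+ (d ℕ.+ n ℕ.* d) ≡ (i ℕ.+ n ℕ.* d) ℕ.+ d
    i+[d+nd]≡[i+nd]+d = ≡.trans (≡.cong (i ℕ.+_) (ℕ.+-comm d _)) (≡.sym (ℕ.+-assoc i _ d))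

    -- Truncated subtraction satisfies 1 + (n ∸ (h + 1)) = n ∸ h only for h < n, which the bound on
    -- `Fin n` supplies.
    initial : ∀ h → w (suc (n ∸ suc (toℕ h))) (i ℕ.+ toℕ h ℕ.* d) ≈ v (toℕ (Fin.inject₁ h))
    initial h = reflexive (≡.trans
      (≡.cong (λ m → w m (i ℕ.+ toℕ h ℕ.* d)) (≡.sym (ℕ.+-∸-assoc 1 (Fin.toℕ<n h))))
      (≡.cong v (≡.sym (Fin.toℕ-inject₁ h))))

    final : w 0 (i ℕ.+ n ℕ.* d) ≈ v (toℕ (Fin.fromℕ n))
    final = reflexive (≡.trans
      (≡.cong (λ m → w m (i ℕ.+ n ℕ.* d)) (≡.sym (ℕ.n∸n≡0 n)))
      (≡.cong v (≡.sym (Fin.toℕ-fromℕ n))))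

  ⨁-isShift : ∀ n (S : ℕ → Carrier) →
              IsShift 0 (λ i → ∑[ n ] λ k → S (toℕ k) * (fromℕ i ↓ toℕ k))
                        (⨁[ n ] λ k → S (toℕ k) • ((X ^ᵒ toℕ k) ∘ (D ^ᵒ toℕ k)))
  ⨁-isShift n S f i = begin
    coeff ((⨁[ n ] λ k → S (toℕ k) • T (toℕ k)) f) (i ℕ.+ 0)
      ≈⟨ coeff-⨁ n (λ k → S (toℕ k) • T (toℕ k)) f (i ℕ.+ 0) ⟩
    (∑[ n ] λ k → coeff (S (toℕ k) *ᵖ T (toℕ k) f) (i ℕ.+ 0))
      ≈⟨ sum-cong-≋ {n} (λ k → term (toℕ k)) ⟩
    (∑[ n ] λ k → coeff f i * (S (toℕ k) * (fromℕ i ↓ toℕ k)))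
      ≈⟨ *-distribˡ-sum {n} _ (λ k → S (toℕ k) * (fromℕ i ↓ toℕ k)) ⟨
    coeff f i * (∑[ n ] λ k → S (toℕ k) * (fromℕ i ↓ toℕ k))
      ≈⟨ *-comm _ _ ⟩
    (∑[ n ] λ k → S (toℕ k) * (fromℕ i ↓ toℕ k)) * coeff f i ∎
    where
    T : ℕ → Op
    T k = (X ^ᵒ k) ∘ (D ^ᵒ k)

    term : ∀ k → coeff (S k *ᵖ T k f) (i ℕ.+ 0) ≈ coeff f i * (S k * (fromℕ i ↓ k))
    term k = begin
      coeff (S k *ᵖ T k f) (i ℕ.+ 0)     ≈⟨ coeff-*ᵖ (S k) (T k f) (i ℕ.+ 0) ⟩
      -- Zero is rewritten as `k ∸ k` so that the term is a case of `X^D^-isShift` with r = s = k.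
      S k * coeff (T k f) (i ℕ.+ 0)      ≡⟨ ≡.cong (λ d → S k * coeff (T k f) (i ℕ.+ d)) (ℕ.n∸n≡0 k) ⟨
      S k * coeff (T k f) (i ℕ.+ (k ∸ k)) ≈⟨ *-congˡ (X^D^-isShift (ℕ.≤-refl {k}) f i) ⟩
      S k * ((fromℕ i ↓ k) * coeff f i)  ≈⟨ *-assoc _ _ _ ⟨
      S k * (fromℕ i ↓ k) * coeff f i    ≈⟨ *-comm _ _ ⟩
      coeff f i * (S k * (fromℕ i ↓ k))  ∎

  -- A weight can be read off by applying the operator to the monomial x^i, whose coefficient at i
  -- is 1.
  weights-equal : ∀ {d v w} T U → IsShift d v T → IsShift d w U → T ≈ᵒ U → ∀ i → v i ≈ w i
  weights-equal {d} {v} {w} T U T-shift U-shift T≈U i = begin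
    v i                      ≈⟨ *-identityʳ _ ⟨
    v i * 1#                 ≈⟨ *-congˡ x^i[i]≈1 ⟨
    v i * coeff x^i i        ≈⟨ T-shift x^i i ⟨
    coeff (T x^i) (i ℕ.+ d)  ≈⟨ T≈U x^i (i ℕ.+ d) ⟩
    coeff (U x^i) (i ℕ.+ d)  ≈⟨ U-shift x^i i ⟩
    w i * coeff x^i i        ≈⟨ *-congˡ x^i[i]≈1 ⟩
    w i * 1#                 ≈⟨ *-identityʳ _ ⟩
    w i                      ∎
    where
    x^i = (X ^ᵒ i) (1# ∷ [])
    x^i[i]≈1 : coeff x^i i ≈ 1#
    x^i[i]≈1 = trans (X^-isShift i (1# ∷ []) 0) (*-identityˡ 1#)

  -- Expansion of the product in falling factorials, and extraction of its coefficients.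

  stirling₂-expansion : ∀ Λ {r s} n S → s ≤ r → IsDegenerateStirling₂ Λ r s n S → ∀ p →
    (∏[ n ] λ h → (fromℕ (p ℕ.+ toℕ h ℕ.* (r ∸ s)) ↓ s) - fromℕ (n ∸ suc (toℕ h)) * Λ)
      ≈ (∑[ suc (n ℕ.* s) ] λ k → S (toℕ k) * (fromℕ p ↓ toℕ k))
  stirling₂-expansion Λ {r} {s} n S s≤r stirling p = begin
    (∏[ n ] λ h → (fromℕ (p ℕ.+ toℕ h ℕ.* d) ↓ s) - fromℕ (n ∸ suc (toℕ h)) * Λ)
      ≈⟨ ∏.sum-cong-≋ {n} (λ h → +-congˡ (-‿cong (*-identityʳ _))) ⟨
    -- With j = h + 1, the factor of index n - j meets a degree already raised by (j - 1)(r - s).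
    (∏[ n ] λ h → w (n ∸ suc (toℕ h)) (p ℕ.+ toℕ h ℕ.* d))
      ≈⟨ weights-equal (∘[ n ] factor) ((X ^ᵒ (n ℕ.* d)) ∘ U)
           (∘-isShift n factor w factor-isShift)
           rhs-isShift stirling p ⟩
    (∑[ suc (n ℕ.* s) ] λ k → S (toℕ k) * (fromℕ p ↓ toℕ k)) ∎
    where
    d = r ∸ s

    w : ℕ → ℕ → Carrier
    -- The trailing `1#` is the weight of `X ^ᵒ d`, kept so that `⊖-•-isShift` applies verbatim.
    w k i = (fromℕ i ↓ s) - fromℕ k * Λ * 1#

    factor : Fin n → Op
    factor k = ((X ^ᵒ r) ∘ (D ^ᵒ s)) ⊖ (fromℕ (toℕ k) * Λ) • (X ^ᵒ d)

    factor-isShift : ∀ k → IsShift d (w (toℕ k)) (factor k)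
    factor-isShift k = ⊖-•-isShift ((X ^ᵒ r) ∘ (D ^ᵒ s)) (X ^ᵒ d) (fromℕ (toℕ k) * Λ)
      (X^D^-isShift s≤r) (X^-isShift d)

    U : Op
    U = ⨁[ suc (n ℕ.* s) ] λ k → S (toℕ k) • ((X ^ᵒ toℕ k) ∘ (D ^ᵒ toℕ k))

    rhs-isShift : IsShift (n ℕ.* d)
                    (λ i → ∑[ suc (n ℕ.* s) ] λ k → S (toℕ k) * (fromℕ i ↓ toℕ k))
                    ((X ^ᵒ (n ℕ.* d)) ∘ U)
    rhs-isShift f i = begin
      coeff ((X ^ᵒ (n ℕ.* d)) (U f)) (i ℕ.+ n ℕ.* d) ≈⟨ X^-isShift (n ℕ.* d) (U f) i ⟩
      1# * coeff (U f) i                             ≈⟨ *-identityˡ _ ⟩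
      coeff (U f) i                                  ≡⟨ ≡.cong (coeff (U f)) (ℕ.+-identityʳ i) ⟨
      coeff (U f) (i ℕ.+ 0)                          ≈⟨ ⨁-isShift (suc (n ℕ.* s)) S f i ⟩
      (∑[ suc (n ℕ.* s) ] λ k → S (toℕ k) * (fromℕ i ↓ toℕ k)) * coeff f i ∎

  -- Linearity leaves only alternating sums of single falling factorials, which are known on and off
  -- the diagonal.
  Δ-↓-expansion : ∀ k N (S : ℕ → Carrier) →
    Δ k (λ p → ∑[ N ] λ j → S (toℕ j) * (fromℕ p ↓ toℕ j))
      ≈ (∑[ N ] λ j → S (toℕ j) * Δ k (λ p → fromℕ p ↓ toℕ j))
  Δ-↓-expansion k N S = trans
    (Δ-∑ k N λ j p → S (toℕ j) * (fromℕ p ↓ toℕ j))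
    (sum-cong-≋ {N} λ j → Δ-* k (S (toℕ j)) λ p → fromℕ p ↓ toℕ j)

  -- The prefactor cancels the diagonal value of `Δ k`: the signs square to 1, and k! meets its
  -- reciprocal.
  normalisation : ∀ (char0 : CharacteristicZero) k a →
    ((- 1#) ^ k * (1/ k !) char0) * (a * ((- 1#) ^ k * fromℕ (k !))) ≈ a
  normalisation char0 k a = begin
    ((- 1#) ^ k * (1/ k !) char0) * (a * ((- 1#) ^ k * fromℕ (k !)))
      ≈⟨ x∙yz≈y∙xz _ _ _ ⟩
    a * (((- 1#) ^ k * (1/ k !) char0) * ((- 1#) ^ k * fromℕ (k !)))
      ≈⟨ *-congˡ (interchange _ _ _ _) ⟩
    a * (((- 1#) ^ k * (- 1#) ^ k) * ((1/ k !) char0 * fromℕ (k !)))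
      ≈⟨ *-congˡ (*-cong (-1^k*-1^k≈1 k) (recip*x≈1 _)) ⟩
    a * (1# * 1#)  ≈⟨ *-congˡ (*-identityˡ 1#) ⟩
    a * 1#         ≈⟨ *-identityʳ a ⟩
    a              ∎

theorem3 : ∀ {c ℓ₁ ℓ₂} (K : HeytingField c ℓ₁ ℓ₂) →
    let open DegenerateStirling K in
    (char0 : CharacteristicZero) →
    (Λ : Carrier) (r s n : ℕ) → 1 ≤ s → s ≤ r → 1 ≤ n →
    (S : ℕ → Carrier) → IsDegenerateStirling₂ Λ r s n S →
    (k : ℕ) →
    let
      lhs = ((- 1#) ^ k * (1/ k !) char0) *
            (∑[ suc k ] λ i → let p = toℕ i in
              (- 1#) ^ p * fromℕ (k C p) *
              (∏[ n ] λ h → let j = suc (toℕ h) in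
                (fromℕ (p ℕ.+ (j ∸ 1) ℕ.* (r ∸ s)) ↓ s) - fromℕ (n ∸ j) * Λ))
    in
    (k ≤ n ℕ.* s → lhs ≈ S k) × (n ℕ.* s < k → lhs ≈ 0#)
theorem3 K char0 Λ r s n _ s≤r _ S stirling k = within , beyond
  where
  open DegenerateStirling K
  open CommutativeRing (HeytingCommutativeRing.commutativeRing (HeytingField.heytingCommutativeRing K))
    using (setoid; trans; *-congˡ; zeroʳ)
  open SetoidReasoning setoid

  -- The indices 0, ..., n s include both ends.
  N = suc (n ℕ.* s)

  product : ℕ → Carrier
  product p = ∏[ n ] λ h → (fromℕ (p ℕ.+ toℕ h ℕ.* (r ∸ s)) ↓ s) - fromℕ (n ∸ suc (toℕ h)) * Λ

  factor : Carrier
  factor = (- 1#) ^ k * (1/ k !) char0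

  t : ℕ → Carrier
  t j = S j * Δ K k (λ p → fromℕ p ↓ j)

  Δ-product : Δ K k product ≈ (∑[ N ] t ∘ toℕ)
  Δ-product = trans (Δ-cong K k (stirling₂-expansion K Λ n S s≤r stirling)) (Δ-↓-expansion K k N S)

  t≈0 : ∀ j → j ≢ k → t j ≈ 0#
  t≈0 j j≢k = trans (*-congˡ (Δ-↓-offDiagonal K k j j≢k)) (zeroʳ (S j))

  within : k ≤ n ℕ.* s → factor * Δ K k product ≈ S k
  within k≤ns = begin
    factor * Δ K k product                      ≈⟨ *-congˡ Δ-product ⟩
    -- As k ≤ n s, the diagonal index k occurs in the sum and is the only one to survive.
    factor * (∑[ N ] t ∘ toℕ)                   ≈⟨ *-congˡ (∑-single K N k t t≈0 (s≤s k≤ns)) ⟩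
    factor * t k                                ≈⟨ *-congˡ (*-congˡ (Δ-↓-diagonal K k)) ⟩
    factor * (S k * ((- 1#) ^ k * fromℕ (k !))) ≈⟨ normalisation K char0 k (S k) ⟩
    S k                                         ∎

  beyond : n ℕ.* s < k → factor * Δ K k product ≈ 0#
  beyond ns<k = begin
    factor * Δ K k product    ≈⟨ *-congˡ Δ-product ⟩
    -- Every index is at most n s, hence less than k: the sum has no diagonal term.
    factor * (∑[ N ] t ∘ toℕ) ≈⟨ *-congˡ (∑-zero K N _ λ j → t≈0 (toℕ j) (ℕ.<⇒≢ (ℕ.≤-trans (Fin.toℕ<n j) ns<k))) ⟩
    factor * 0#               ≈⟨ zeroʳ factor ⟩
    0#                        ∎
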